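{- Let $k\ge 1$ be an integer. For any graph $G$ of order $n$ with minimum vertex degree $\delta\ge k-1$, $$ L_k(G)\le\gamma_{\times k}(G). $$
   Context: Graphs are finite, simple and undirected. $N[v]$ denotes the closed neighbourhood of a vertex $v$ (the vertex $v$ together with all its neighbours). A vertex set $X\subseteq V(G)$ is a $k$-limited packing of $G$ if $|N[v]\cap X|\le k$ for every vertex $v\in V(G)$; the $k$-limited packing number $L_k(G)$ is the maximum size of a $k$-limited packing in $G$. A vertex set $X\subseteq V(G)$ is a $k$-tuple dominating set of $G$ if $|N[v]\cap X|\ge k$ for every vertex $v\in V(G)$; the $k$-tuple domination number $\gamma_{\times k}(G)$ is the minimum size of a $k$-tuple dominating set of $G$ (it is defined exactly when $\delta\ge k-1$). -}

module Defs where

open import Data.Fin.Base using (Fin; zero)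
open import Data.Fin.Properties using (any?; all?)
open import Data.Fin.Subset using (Subset; ⊤; ⊥; ⁅_⁆; _∉_; _∩_; _∪_; ∣_∣)
open import Data.Fin.Subset.Properties using (anySubset?; x∈⁅x⁆; p⊆p∪q; q⊆p∪q; p⊂q⇒∣p∣<∣q∣; ∣p∣≤n; ∣⊥∣≡0; ∩-zeroʳ; ∩-identityʳ)
open import Data.Nat.Base using (ℕ; suc; _∸_; _≤_; _≥_; _<_; z≤n; s≤s; NonZero)
open import Data.Nat.Properties using (_≤?_; _<?_; _≥?_; ≮⇒≥; ∸-cancelʳ-≤; m≤n+m∸n; module ≤-Reasoning)
open import Data.Nat.Induction using (<-wellFounded)
open import Data.Product.Base using (∃; _×_; _,_; proj₁; proj₂)
open import Data.Vec.Base using (tabulate)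
open import Data.Vec.Properties using (lookup∘tabulate; []=⇒lookup)
open import Induction.WellFounded using (Acc; acc)
open import Level using (0ℓ)
open import Relation.Binary.Core using (Rel)
open import Relation.Binary.Definitions using (Symmetric; Irreflexive) renaming (Decidable to Decidable₂)
open import Relation.Binary.PropositionalEquality using (_≡_; refl; sym; trans; cong)
open import Relation.Nullary using (Dec; yes; no; does)
open import Relation.Nullary.Decidable using (_×-dec_; dec-false)
open import Relation.Unary using (Pred; Decidable; U)
open import Relation.Unary.Properties using (U?)

private
  variable
    n : ℕ
    A : Set

record Graph (n : ℕ) : Set₁ where
  infix 4 _~_ _~?_
  field
    _~_      : Rel (Fin n) 0ℓ
    _~?_     : Decidable₂ _~_
    ~-sym    : Symmetric _~_
    ~-irrefl : Irreflexive _≡_ _~_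

  N : Fin n → Subset n
  N v = tabulate (λ u → does (v ~? u))

  N[_] : Fin n → Subset n
  N[ v ] = ⁅ v ⁆ ∪ N v

  degree : Fin n → ℕ
  degree v = ∣ N v ∣

  v∉Nv : ∀ v → v ∉ N v
  v∉Nv v v∈Nv with () ← trans (sym ([]=⇒lookup v∈Nv))
    (trans (lookup∘tabulate _ v) (dec-false (v ~? v) (~-irrefl refl)))

  degree<∣N[v]∣ : ∀ v → degree v < ∣ N[ v ] ∣
  degree<∣N[v]∣ v = p⊂q⇒∣p∣<∣q∣
    (q⊆p∪q ⁅ v ⁆ (N v) , v , p⊆p∪q (N v) (x∈⁅x⁆ v) , v∉Nv v)

IsMaximum : (A → ℕ) → Pred A 0ℓ → ℕ → Set
IsMaximum f P m = (∃ λ x → P x × f x ≡ m) × (∀ x → P x → f x ≤ m)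

IsMinimum : (A → ℕ) → Pred A 0ℓ → ℕ → Set
IsMinimum f P m = (∃ λ x → P x × f x ≡ m) × (∀ x → P x → m ≤ f x)

Searchable : Set → Set₁
Searchable A = ∀ {P : Pred A 0ℓ} → Decidable P → Dec (∃ P)

minimum : Searchable A → (f : A → ℕ) {P : Pred A 0ℓ} →
          Decidable P → ∃ P → ∃ (IsMinimum f P)
minimum search f {P} P? (x₀ , px₀) = go x₀ px₀ (<-wellFounded (f x₀))
  where
  go : ∀ x → P x → Acc _<_ (f x) → ∃ (IsMinimum f P)
  go x px (acc rs) with search (λ y → P? y ×-dec (f y <? f x))
  ... | yes (y , py , fy<fx) = go y py (rs fy<fx)
  ... | no ∄y = f x , (x , px , refl) , λ y py → ≮⇒≥ λ fy<fx → ∄y (y , py , fy<fx)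

maximum : Searchable A → (f : A → ℕ) (b : ℕ) → (∀ x → f x ≤ b) →
          {P : Pred A 0ℓ} → Decidable P → ∃ P → ∃ (IsMaximum f P)
maximum search f b f≤b P? w with minimum search (λ x → b ∸ f x) P? w
... | _ , (x , px , refl) , least =
  f x , (x , px , refl) , λ y py → ∸-cancelʳ-≤ (f≤b y) (least y py)

vertex : ∀ n .{{_ : NonZero n}} → Fin n
vertex (suc _) = zero

module _ (G : Graph n) .{{_ : NonZero n}} where
  open Graph G

  minDegree : ∃ (IsMinimum degree U)
  minDegree = minimum any? degree U? (vertex n , _)

  δ : ℕ
  δ = proj₁ minDegree

module _ (k : ℕ) (G : Graph n) where
  open Graph G

  IsLimitedPacking : Pred (Subset n) 0ℓ
  IsLimitedPacking X = ∀ v → ∣ N[ v ] ∩ X ∣ ≤ k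

  IsTupleDominating : Pred (Subset n) 0ℓ
  IsTupleDominating X = ∀ v → ∣ N[ v ] ∩ X ∣ ≥ k

  isLimitedPacking? : Decidable IsLimitedPacking
  isLimitedPacking? X = all? (λ v → ∣ N[ v ] ∩ X ∣ ≤? k)

  isTupleDominating? : Decidable IsTupleDominating
  isTupleDominating? X = all? (λ v → ∣ N[ v ] ∩ X ∣ ≥? k)

  ⊥-isLimitedPacking : IsLimitedPacking ⊥
  ⊥-isLimitedPacking v = begin
    ∣ N[ v ] ∩ ⊥ ∣  ≡⟨ cong ∣_∣ (∩-zeroʳ N[ v ]) ⟩
    ∣ ⊥ {n} ∣       ≡⟨ ∣⊥∣≡0 n ⟩
    0               ≤⟨ z≤n ⟩
    k               ∎
    where open ≤-Reasoning

  maxLimitedPacking : ∃ (IsMaximum ∣_∣ IsLimitedPacking)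
  maxLimitedPacking =
    maximum anySubset? ∣_∣ n ∣p∣≤n isLimitedPacking? (⊥ , ⊥-isLimitedPacking)

  L : ℕ
  L = proj₁ maxLimitedPacking

  module _ .{{_ : NonZero n}} (δ≥k-1 : δ G ≥ k ∸ 1) where

    ⊤-isTupleDominating : IsTupleDominating ⊤
    ⊤-isTupleDominating v = begin
      k               ≤⟨ m≤n+m∸n k 1 ⟩
      suc (k ∸ 1)     ≤⟨ s≤s δ≥k-1 ⟩
      suc (δ G)       ≤⟨ s≤s (proj₂ (proj₂ (minDegree G)) v _) ⟩
      suc (degree v)  ≤⟨ degree<∣N[v]∣ v ⟩
      ∣ N[ v ] ∣      ≡⟨ cong ∣_∣ (∩-identityʳ N[ v ]) ⟨
      ∣ N[ v ] ∩ ⊤ ∣  ∎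
      where open ≤-Reasoning

    minTupleDominating : ∃ (IsMinimum ∣_∣ IsTupleDominating)
    minTupleDominating =
      minimum anySubset? ∣_∣ isTupleDominating? (⊤ , ⊤-isTupleDominating)

    -- The k-tuple domination number exists only when δ ≥ k - 1, hence the
    -- hypothesis among its arguments.
    γ× : ℕ
    γ× = proj₁ minTupleDominating

{-# OPTIONS --safe #-}

-- Count the pairs (x , y) with x in a k-limited packing X, y in a k-tuple
-- dominating set D and y ∈ N[x].  Each x contributes at least k of them and,
-- as y ∈ N[x] iff x ∈ N[y], each y contributes at most k, so
-- ∣ X ∣ * k ≤ ∣ D ∣ * k.

module Submission where

open import Defs
open import Data.Bool.Base using (Bool; true; false; _∧_; _∨_)
open import Data.Fin.Base using (Fin; zero; suc)
open import Data.Fin.Subset using (Subset; ⁅_⁆; _∩_; ∣_∣)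
open import Data.Nat.Base using (ℕ; _+_; _*_; _≤_; _≥_; _∸_; z≤n; NonZero; >-nonZero)
open import Data.Nat.Properties
open import Data.Product.Base using (_,_; proj₂)
open import Data.Vec.Base using ([]; _∷_; lookup)
open import Data.Vec.Functional using (Vector)
open import Data.Vec.Functional.Relation.Binary.Pointwise.Properties using (foldr-cong)
open import Data.Vec.Properties using (lookup-zipWith; lookup-replicate; lookup∘tabulate)
open import Function.Bundles using (mk⇔)
open import Relation.Binary.PropositionalEquality
open import Relation.Nullary.Decidable using (does-⇔)

open import Algebra.Properties.Semiring.Sum +-*-semiring
  using (sum; sum-syntax; sum-cong-≗; ∑-comm; *-distribˡ-sum; *-distribʳ-sum)

private
  variable
    n : ℕ

sum-mono-≤ : {f g : Vector ℕ n} → (∀ i → f i ≤ g i) → sum f ≤ sum g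
sum-mono-≤ = foldr-cong {R = _≤_} {S = _≤_} +-mono-≤ z≤n

-- The Iverson bracket: set sizes become sums of 0/1 entries and intersections become products, so
-- the counting turns into semiring algebra.
⟦_⟧ : Bool → ℕ
⟦ false ⟧ = 0
⟦ true  ⟧ = 1

⟦∧⟧ : ∀ a b → ⟦ a ∧ b ⟧ ≡ ⟦ a ⟧ * ⟦ b ⟧
⟦∧⟧ false b = refl
⟦∧⟧ true  b = sym (+-identityʳ ⟦ b ⟧)

∣p∣≡∑ : (p : Subset n) → ∣ p ∣ ≡ ∑[ i < n ] ⟦ lookup p i ⟧
∣p∣≡∑ []          = refl
∣p∣≡∑ (true  ∷ p) = cong (1 +_) (∣p∣≡∑ p)
∣p∣≡∑ (false ∷ p) = ∣p∣≡∑ p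

∣p∣*k≡∑ : (p : Subset n) (k : ℕ) → ∣ p ∣ * k ≡ ∑[ i < n ] (⟦ lookup p i ⟧ * k)
∣p∣*k≡∑ p k = trans (cong (_* k) (∣p∣≡∑ p)) (*-distribʳ-sum k (λ i → ⟦ lookup p i ⟧))

∣p∩q∣≡∑ : (p q : Subset n) → ∣ p ∩ q ∣ ≡ ∑[ i < n ] (⟦ lookup p i ⟧ * ⟦ lookup q i ⟧)
∣p∩q∣≡∑ p q = trans (∣p∣≡∑ (p ∩ q)) (sum-cong-≗ λ i →
  trans (cong ⟦_⟧ (lookup-zipWith _∧_ i p q)) (⟦∧⟧ (lookup p i) (lookup q i)))

lookup-⁅⁆-comm : (i j : Fin n) → lookup ⁅ i ⁆ j ≡ lookup ⁅ j ⁆ i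
lookup-⁅⁆-comm zero    zero    = refl
lookup-⁅⁆-comm zero    (suc j) = lookup-replicate j false
lookup-⁅⁆-comm (suc i) zero    = sym (lookup-replicate i false)
lookup-⁅⁆-comm (suc i) (suc j) = lookup-⁅⁆-comm i j

module _ (G : Graph n) where
  open Graph G

  -- The two entries come from different runs of the decision procedure; `~-sym` makes the decided
  -- propositions equivalent, and equivalent propositions have equal `does`.
  lookup-N-comm : ∀ u v → lookup (N u) v ≡ lookup (N v) u
  lookup-N-comm u v = begin
    lookup (N u) v   ≡⟨ lookup∘tabulate _ v ⟩
    _                ≡⟨ does-⇔ (mk⇔ ~-sym ~-sym) (u ~? v) (v ~? u) ⟩
    _                ≡⟨ lookup∘tabulate _ u ⟨
    lookup (N v) u   ∎
    where open ≡-Reasoning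

  -- The matrix of closed neighbourhoods is the entrywise disjunction of the identity and the
  -- adjacency matrix, both symmetric.
  lookup-N[]-comm : ∀ u v → lookup N[ u ] v ≡ lookup N[ v ] u
  lookup-N[]-comm u v = begin
    lookup N[ u ] v                    ≡⟨ lookup-zipWith _∨_ v ⁅ u ⁆ (N u) ⟩
    lookup ⁅ u ⁆ v ∨ lookup (N u) v    ≡⟨ cong₂ _∨_ (lookup-⁅⁆-comm u v) (lookup-N-comm u v) ⟩
    lookup ⁅ v ⁆ u ∨ lookup (N v) u    ≡⟨ lookup-zipWith _∨_ u ⁅ v ⁆ (N v) ⟨
    lookup N[ v ] u                    ∎
    where open ≡-Reasoning

  -- The number of pairs (v , y) with v in X and y in N[v] ∩ Y, grouped by v so that a bound on
  -- every `∣ N[ v ] ∩ Y ∣` applies summand by summand.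
  incidences : Subset n → Subset n → ℕ
  incidences X Y = ∑[ v < n ] (⟦ lookup X v ⟧ * ∣ N[ v ] ∩ Y ∣)

  incidences≡∑∑ : ∀ X Y → incidences X Y ≡
    ∑[ u < n ] ∑[ v < n ] (⟦ lookup X u ⟧ * (⟦ lookup N[ u ] v ⟧ * ⟦ lookup Y v ⟧))
  incidences≡∑∑ X Y = sum-cong-≗ λ u →
    trans (cong (⟦ lookup X u ⟧ *_) (∣p∩q∣≡∑ N[ u ] Y))
          (*-distribˡ-sum ⟦ lookup X u ⟧ (λ v → ⟦ lookup N[ u ] v ⟧ * ⟦ lookup Y v ⟧))

  -- The double count: `incidences` is the bilinear form of the symmetric closed-neighbourhood
  -- matrix at two indicator vectors.
  incidences-comm : ∀ X Y → incidences X Y ≡ incidences Y X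
  incidences-comm X Y = begin
    incidences X Y                        ≡⟨ incidences≡∑∑ X Y ⟩
    ∑[ u < n ] ∑[ v < n ] term X Y u v    ≡⟨ ∑-comm (term X Y) ⟩
    ∑[ v < n ] ∑[ u < n ] term X Y u v    ≡⟨ sum-cong-≗ (λ v → sum-cong-≗ (λ u → term-comm u v)) ⟩
    ∑[ v < n ] ∑[ u < n ] term Y X v u    ≡⟨ incidences≡∑∑ Y X ⟨
    incidences Y X                        ∎
    where
    open ≡-Reasoning

    term : Subset n → Subset n → Fin n → Fin n → ℕ
    term X Y u v = ⟦ lookup X u ⟧ * (⟦ lookup N[ u ] v ⟧ * ⟦ lookup Y v ⟧)

    term-comm : ∀ u v → term X Y u v ≡ term Y X v u
    term-comm u v = begin
      -- The graph enters here only; the remaining steps reverse a product of three factors.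
      x * (⟦ lookup N[ u ] v ⟧ * y)    ≡⟨ cong (λ b → x * (⟦ b ⟧ * y)) (lookup-N[]-comm u v) ⟩
      x * (m * y)                      ≡⟨ *-comm x (m * y) ⟩
      m * y * x                        ≡⟨ cong (_* x) (*-comm m y) ⟩
      y * m * x                        ≡⟨ *-assoc y m x ⟩
      y * (m * x)                      ∎
      where
      x = ⟦ lookup X u ⟧
      y = ⟦ lookup Y v ⟧
      m = ⟦ lookup N[ v ] u ⟧

  packing≤dominating : ∀ {k} .{{_ : NonZero k}} {X D} →
    IsLimitedPacking k G X → IsTupleDominating k G D → ∣ X ∣ ≤ ∣ D ∣
  packing≤dominating {k} {X} {D} packing dominating = *-cancelʳ-≤ ∣ X ∣ ∣ D ∣ k (begin
    ∣ X ∣ * k                           ≡⟨ ∣p∣*k≡∑ X k ⟩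
    -- The roles cross: domination by D is used at the vertices of X, and below, the packing bound
    -- on X at the vertices of D.
    ∑[ v < n ] (⟦ lookup X v ⟧ * k)     ≤⟨ sum-mono-≤ (λ v → *-monoʳ-≤ ⟦ lookup X v ⟧ (dominating v)) ⟩
    incidences X D                      ≡⟨ incidences-comm X D ⟩
    incidences D X                      ≤⟨ sum-mono-≤ (λ v → *-monoʳ-≤ ⟦ lookup D v ⟧ (packing v)) ⟩
    ∑[ v < n ] (⟦ lookup D v ⟧ * k)     ≡⟨ ∣p∣*k≡∑ D k ⟨
    ∣ D ∣ * k                           ∎)
    where open ≤-Reasoning

theorem3 : (k : ℕ) → k ≥ 1 → (n : ℕ) .{{_ : NonZero n}} (G : Graph n) →
    (δ≥k-1 : δ G ≥ k ∸ 1) → L k G ≤ γ× k G δ≥k-1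
theorem3 k k≥1 n G δ≥k-1
  -- Both extrema are attained, so it suffices to compare one packing of size `L` with one
  -- dominating set of size `γ×`.
  with (X , packing , ∣X∣≡L) , _ ← proj₂ (maxLimitedPacking k G)
     | (D , dominating , ∣D∣≡γ) , _ ← proj₂ (minTupleDominating k G δ≥k-1)
  = subst₂ _≤_ ∣X∣≡L ∣D∣≡γ (packing≤dominating G {{>-nonZero k≥1}} packing dominating)
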